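{- Let $\mathsf{CS}$ be a constant specification for $\mathsf{Base}$. For any formula $A\in\mathcal{L}_{\mathsf J}$: if $\vdash_{\mathsf{JIK}_{\mathsf{CS}}}A$ then $\vDash_{\mathsf b}A$, i.e. $A$ is true at every world of every basic model.
   Context: **Justification language.** Fix countable sets $\mathsf{Prop}$ (propositional variables), $\mathsf{PrfConst}$ (proof constants), $\mathsf{PrfVar}$ (proof variables), $\mathsf{SatVar}$ (satisfier variables). Proof terms $t\in\mathsf{PrfTm}$ and satisfier terms $m\in\mathsf{SatTm}$ are defined by mutual induction: $t ::= c\in\mathsf{PrfConst}\mid x\in\mathsf{PrfVar}\mid t\cdot t\mid t+t\mid {!t}\mid m\triangleright t$ and $m ::= a\in\mathsf{SatVar}\mid m\sqcup m\mid t\star m$. The justification language $\mathcal{L}_{\mathsf J}$ is $A ::= p\in\mathsf{Prop}\mid\bot\mid A\wedge A\mid A\vee A\mid A\to A\mid [t]A\mid\langle m\rangle A$. **The logic $\mathsf{JIK}_{\mathsf{CS}}$.** Let $\mathsf{Int}$ be a finite set of axiom (schemes) for intuitionistic propositional logic (complete with modus ponens). The axiom set $\mathsf{Base}$ is $\mathsf{Int}$ (over $\mathcal{L}_{\mathsf J}$) together with: $[s](A\to B)\to([t]A\to[s\cdot t]B)$; $[s](A\to B)\to(\langle m\rangle A\to\langle s\star m\rangle B)$; $\langle m\rangle(A\vee B)\to(\langle m\rangle A\vee\langle m\rangle B)$; $(\langle m\rangle A\to[t]B)\to[m\triangleright t](A\to B)$; $\langle m\rangle\bot\to\bot$; $[s]A\to[s+t]A$;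 $[t]A\to[s+t]A$; $\langle m\rangle A\to\langle m\sqcup n\rangle A$; $\langle n\rangle A\to\langle m\sqcup n\rangle A$. A constant specification $\mathsf{CS}$ is any set of formulas $[c]A$ with $c\in\mathsf{PrfConst}$ and $A$ an axiom instance of $\mathsf{Base}$. For finite $\Gamma$, $\Gamma\vdash_{\mathsf{JIK}_{\mathsf{CS}}}A$ means $\Gamma\vdash A$ is derivable with: ($\mathsf{ax}$) $\Gamma\vdash A$ for $A$ an axiom instance of $\mathsf{Base}$; ($\mathsf{id}$) $\Gamma\vdash A$ for $A\in\Gamma$; ($\mathsf{mp}$) from $\Gamma\vdash A$ and $\Gamma\vdash A\to B$ infer $\Gamma\vdash B$; ($\mathsf{can}$) $\Gamma\vdash[!^k c]\cdots[!c][c]A$ for any $[c]A\in\mathsf{CS}$ and $k\ge 0$, where $!^k c$ is $k$-fold application of $!$ to $c$. $\vdash_{\mathsf{JIK}_{\mathsf{CS}}}A$ means $\emptyset\vdash_{\mathsf{JIK}_{\mathsf{CS}}}A$. **Basic models.** For sets of formulas $X,Y$ let $X\cdot Y:=\{B\mid A\to B\in X\text{ and }A\in Y\text{ for some }A\}$. A basic (intuitionistic modular) model (for $\mathsf{CS}$) is a tuple $\mathcal B=(W,\le,*)$ with $W$ a non-empty set, $\le$ a preorder on $W$, and $*$ assigning to each $p\in\mathsf{Prop}$ and $w\in W$ a value $p^*_w\in\{0,1\}$ and to each proof or satisfier term $s$ and $w\in W$ a set of formulas $s^*_w\subseteq\mathcal{L}_{\mathsf J}$, such that for all $w\in W$,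 proof terms $s,t$, satisfier terms $m,n$ and formulas $A,B$: (M1) if $w\le v$ and $p^*_w=1$ then $p^*_v=1$; (M2) if $w\le v$ then $t^*_w\subseteq t^*_v$ and $m^*_w\subseteq m^*_v$; (1) $s^*_w\cdot t^*_w\subseteq(s\cdot t)^*_w$; (2) $s^*_w\cdot m^*_w\subseteq(s\star m)^*_w$; (3) $s^*_w\cup t^*_w\subseteq(s+t)^*_w$; (4) $m^*_w\cup n^*_w\subseteq(m\sqcup n)^*_w$; (5) $A\in t^*_w$ for any formula $[t]A$ that is a conclusion of $\mathsf{can}$; (6) if $A\vee B\in m^*_w$ then $A\in m^*_w$ or $B\in m^*_w$; (7) if for all $v\ge w$, $A\notin m^*_v$ or $B\in t^*_v$, then $A\to B\in(m\triangleright t)^*_w$; (8) $\bot\notin m^*_w$. **Truth.** $\mathcal B,w\Vdash p$ iff $p^*_w=1$; never $\mathcal B,w\Vdash\bot$; $\wedge,\vee$ are evaluated pointwise; $\mathcal B,w\Vdash A\to B$ iff for all $v\ge w$, $\mathcal B,v\Vdash A$ implies $\mathcal B,v\Vdash B$; $\mathcal B,w\Vdash[t]A$ iff $A\in t^*_w$; $\mathcal B,w\Vdash\langle m\rangle A$ iff $A\in m^*_w$. $\vDash_{\mathsf b}A$ means $\mathcal B,w\Vdash A$ for every basic model $\mathcal B$ and every $w\in W$. -}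

module Defs where

open import Data.Bool.Base using (Bool; true)
open import Data.Empty.Polymorphic using () renaming (⊥ to Empty)
open import Data.List.Base using (List; []; _∷_)
open import Data.List.Membership.Propositional using () renaming (_∈_ to _∈ˡ_)
open import Data.Nat.Base using (ℕ; zero; suc)
open import Data.Product.Base using (∃; ∃₂; _×_)
open import Data.Sum.Base using (_⊎_)
open import Function.Bundles using (_↣_; _⇔_)
open import Level as L using (Level; Lift; 0ℓ)
open import Relation.Binary.Core using (Rel)
open import Relation.Binary.PropositionalEquality.Core using (_≡_)
open import Relation.Binary.Structures using (IsPreorder)
open import Relation.Unary using (Pred; _∈_; _∉_; _⊆_; _∪_)

infix  30 !_
infixl 28 _·_ _⋆_ _▷_ _⊙_
infixl 27 _+_ _⊔_
infix  26 [_]_ ⟨_⟩_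
infixr 25 _∧_
infixr 24 _∨_
infixr 23 _⇒_
infix  4 _⊢ⁿ_ _⊢ᵐᵖ_ _,_,_⊢_ _,_⊩_

-- "Countable" includes "finite", so it is expressed by an injection into ℕ.
record Signature : Set₁ where
  field
    PropVar  : Set
    PrfConst : Set
    PrfVar   : Set
    SatVar   : Set
    propVar-countable  : PropVar ↣ ℕ
    prfConst-countable : PrfConst ↣ ℕ
    prfVar-countable   : PrfVar ↣ ℕ
    satVar-countable   : SatVar ↣ ℕ

open Signature public

mutual
  data PrfTm (S : Signature) : Set where
    const : PrfConst S → PrfTm S
    var   : PrfVar S → PrfTm S
    _·_   : PrfTm S → PrfTm S → PrfTm S
    _+_   : PrfTm S → PrfTm S → PrfTm S
    !_    : PrfTm S → PrfTm S
    _▷_   : SatTm S → PrfTm S → PrfTm S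

  data SatTm (S : Signature) : Set where
    var : SatVar S → SatTm S
    _⊔_ : SatTm S → SatTm S → SatTm S
    _⋆_ : PrfTm S → SatTm S → SatTm S

data Formula (S : Signature) : Set where
  var  : PropVar S → Formula S
  ⊥    : Formula S
  _∧_  : Formula S → Formula S → Formula S
  _∨_  : Formula S → Formula S → Formula S
  _⇒_  : Formula S → Formula S → Formula S
  [_]_ : PrfTm S → Formula S → Formula S
  ⟨_⟩_ : SatTm S → Formula S → Formula S

-- Axiom schemes of intuitionistic propositional logic are propositional
-- formulas over metavariables indexed by ℕ. Their instances are obtained by
-- substitution, either by schemes or by formulas of the justification language.
data Scheme : Set where
  var : ℕ → Scheme
  ⊥   : Scheme
  _∧_ : Scheme → Scheme → Scheme
  _∨_ : Scheme → Scheme → Scheme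
  _⇒_ : Scheme → Scheme → Scheme

substitute : (ℕ → Scheme) → Scheme → Scheme
substitute σ (var i) = σ i
substitute σ ⊥       = ⊥
substitute σ (φ ∧ ψ) = substitute σ φ ∧ substitute σ ψ
substitute σ (φ ∨ ψ) = substitute σ φ ∨ substitute σ ψ
substitute σ (φ ⇒ ψ) = substitute σ φ ⇒ substitute σ ψ

instantiate : {S : Signature} → (ℕ → Formula S) → Scheme → Formula S
instantiate σ (var i) = σ i
instantiate σ ⊥       = ⊥
instantiate σ (φ ∧ ψ) = instantiate σ φ ∧ instantiate σ ψ
instantiate σ (φ ∨ ψ) = instantiate σ φ ∨ instantiate σ ψ
instantiate σ (φ ⇒ ψ) = instantiate σ φ ⇒ instantiate σ ψ

-- Intuitionistic propositional logic, presented by natural deduction.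
data _⊢ⁿ_ (Γ : List Scheme) : Scheme → Set where
  hyp : ∀ {φ} → φ ∈ˡ Γ → Γ ⊢ⁿ φ
  ⊥E  : ∀ {φ} → Γ ⊢ⁿ ⊥ → Γ ⊢ⁿ φ
  ∧I  : ∀ {φ ψ} → Γ ⊢ⁿ φ → Γ ⊢ⁿ ψ → Γ ⊢ⁿ φ ∧ ψ
  ∧E₁ : ∀ {φ ψ} → Γ ⊢ⁿ φ ∧ ψ → Γ ⊢ⁿ φ
  ∧E₂ : ∀ {φ ψ} → Γ ⊢ⁿ φ ∧ ψ → Γ ⊢ⁿ ψ
  ∨I₁ : ∀ {φ ψ} → Γ ⊢ⁿ φ → Γ ⊢ⁿ φ ∨ ψ
  ∨I₂ : ∀ {φ ψ} → Γ ⊢ⁿ ψ → Γ ⊢ⁿ φ ∨ ψ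
  ∨E  : ∀ {φ ψ χ} → Γ ⊢ⁿ φ ∨ ψ → φ ∷ Γ ⊢ⁿ χ → ψ ∷ Γ ⊢ⁿ χ → Γ ⊢ⁿ χ
  ⇒I  : ∀ {φ ψ} → φ ∷ Γ ⊢ⁿ ψ → Γ ⊢ⁿ φ ⇒ ψ
  ⇒E  : ∀ {φ ψ} → Γ ⊢ⁿ φ ⇒ ψ → Γ ⊢ⁿ φ → Γ ⊢ⁿ ψ

data _⊢ᵐᵖ_ (Int : List Scheme) : Scheme → Set where
  ax : ∀ {φ} → φ ∈ˡ Int → (σ : ℕ → Scheme) → Int ⊢ᵐᵖ substitute σ φ
  mp : ∀ {φ ψ} → Int ⊢ᵐᵖ φ → Int ⊢ᵐᵖ φ ⇒ ψ → Int ⊢ᵐᵖ ψ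

-- The finitely many schemes in Int, with modus ponens as the only rule,
-- axiomatise exactly intuitionistic propositional logic.
AxiomatisesIPL : List Scheme → Set
AxiomatisesIPL Int = ∀ φ → Int ⊢ᵐᵖ φ ⇔ [] ⊢ⁿ φ

data Base {S : Signature} (Int : List Scheme) : Pred (Formula S) 0ℓ where
  int : ∀ {φ} → φ ∈ˡ Int → (σ : ℕ → Formula S) → Base Int (instantiate σ φ)
  j·  : ∀ s t A B → Base Int ([ s ] (A ⇒ B) ⇒ ([ t ] A ⇒ [ s · t ] B))
  j⋆  : ∀ s m A B → Base Int ([ s ] (A ⇒ B) ⇒ (⟨ m ⟩ A ⇒ ⟨ s ⋆ m ⟩ B))
  j∨  : ∀ m A B → Base Int (⟨ m ⟩ (A ∨ B) ⇒ (⟨ m ⟩ A ∨ ⟨ m ⟩ B))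
  j▷  : ∀ m t A B → Base Int ((⟨ m ⟩ A ⇒ [ t ] B) ⇒ [ m ▷ t ] (A ⇒ B))
  j⊥  : ∀ m → Base Int (⟨ m ⟩ ⊥ ⇒ ⊥)
  j+₁ : ∀ s t A → Base Int ([ s ] A ⇒ [ s + t ] A)
  j+₂ : ∀ s t A → Base Int ([ t ] A ⇒ [ s + t ] A)
  j⊔₁ : ∀ m n A → Base Int (⟨ m ⟩ A ⇒ ⟨ m ⊔ n ⟩ A)
  j⊔₂ : ∀ m n A → Base Int (⟨ n ⟩ A ⇒ ⟨ m ⊔ n ⟩ A)

IsConstantSpecification : ∀ {S c} → List Scheme → Pred (Formula S) c → Set c
IsConstantSpecification Int CS =
  ∀ {F} → F ∈ CS → ∃₂ λ c A → F ≡ [ const c ] A × A ∈ Base Int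

bang^ : ∀ {S} → ℕ → PrfTm S → PrfTm S
bang^ zero    t = t
bang^ (suc k) t = ! (bang^ k t)

-- canFormula k c A is [!ᵏ c]⋯[! c][c] A.
canFormula : ∀ {S} → ℕ → PrfConst S → Formula S → Formula S
canFormula zero    c A = [ const c ] A
canFormula (suc k) c A = [ bang^ (suc k) (const c) ] canFormula k c A

data Can {S : Signature} {c} (CS : Pred (Formula S) c) : Pred (Formula S) c where
  can : ∀ {a A} → [ const a ] A ∈ CS → ∀ k → Can CS (canFormula k a A)

-- Int , CS , Γ ⊢ A is derivability of A from Γ in JIK_CS over the schemes Int.
data _,_,_⊢_ {S : Signature} {c} (Int : List Scheme) (CS : Pred (Formula S) c)
             (Γ : List (Formula S)) : Formula S → Set c where
  ax  : ∀ {A} → A ∈ Base Int → Int , CS , Γ ⊢ A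
  id  : ∀ {A} → A ∈ˡ Γ → Int , CS , Γ ⊢ A
  mp  : ∀ {A B} → Int , CS , Γ ⊢ A → Int , CS , Γ ⊢ A ⇒ B → Int , CS , Γ ⊢ B
  can : ∀ {A} → A ∈ Can CS → Int , CS , Γ ⊢ A

_⊙_ : ∀ {S ℓ} → Pred (Formula S) ℓ → Pred (Formula S) ℓ → Pred (Formula S) ℓ
(X ⊙ Y) B = ∃ λ A → (A ⇒ B) ∈ X × A ∈ Y

-- The components of * on propositional variables, proof terms and satisfier
-- terms are val, prf and sat; the value 1 is true.
record BasicModel {S : Signature} {c} (ℓ : Level) (CS : Pred (Formula S) c)
       : Set (c L.⊔ L.suc ℓ) where
  field
    W          : Set ℓ
    inhabitant : W
    _≤_        : Rel W ℓ
    isPreorder : IsPreorder _≡_ _≤_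
    val        : PropVar S → W → Bool
    prf        : PrfTm S → W → Pred (Formula S) ℓ
    sat        : SatTm S → W → Pred (Formula S) ℓ

    val-mono : ∀ {p w v} → w ≤ v → val p w ≡ true → val p v ≡ true
    prf-mono : ∀ {t w v} → w ≤ v → prf t w ⊆ prf t v
    sat-mono : ∀ {m w v} → w ≤ v → sat m w ⊆ sat m v

    prf-· : ∀ {s t w} → prf s w ⊙ prf t w ⊆ prf (s · t) w
    sat-⋆ : ∀ {s m w} → prf s w ⊙ sat m w ⊆ sat (s ⋆ m) w
    prf-+ : ∀ {s t w} → prf s w ∪ prf t w ⊆ prf (s + t) w
    sat-⊔ : ∀ {m n w} → sat m w ∪ sat n w ⊆ sat (m ⊔ n) w
    prf-can : ∀ {t A w} → [ t ] A ∈ Can CS → A ∈ prf t w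
    sat-∨ : ∀ {m A B w} → (A ∨ B) ∈ sat m w → A ∈ sat m w ⊎ B ∈ sat m w
    -- The disjunction is literal: constructively it is stronger than
    -- A ∈ sat m v → B ∈ prf t v, so the validity of j▷ needs excluded middle.
    prf-▷ : ∀ {m t A B w} →
            (∀ v → w ≤ v → A ∉ sat m v ⊎ B ∈ prf t v) →
            (A ⇒ B) ∈ prf (m ▷ t) w
    sat-⊥ : ∀ {m w} → ⊥ ∉ sat m w

_,_⊩_ : ∀ {S c ℓ} {CS : Pred (Formula S) c} (M : BasicModel ℓ CS) →
        BasicModel.W M → Formula S → Set ℓ
_,_⊩_ {ℓ = ℓ} M w (var p) = Lift ℓ (BasicModel.val M p w ≡ true)
M , w ⊩ ⊥         = Empty
M , w ⊩ (A ∧ B)   = (M , w ⊩ A) × (M , w ⊩ B)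
M , w ⊩ (A ∨ B)   = (M , w ⊩ A) ⊎ (M , w ⊩ B)
M , w ⊩ (A ⇒ B)   = ∀ v → BasicModel._≤_ M w v → M , v ⊩ A → M , v ⊩ B
M , w ⊩ ([ t ] A) = A ∈ BasicModel.prf M t w
M , w ⊩ (⟨ m ⟩ A) = A ∈ BasicModel.sat M m w

⊨ᵇ : ∀ {S c} (ℓ : Level) → Pred (Formula S) c → Formula S → Set (c L.⊔ L.suc ℓ)
⊨ᵇ ℓ CS A = (M : BasicModel ℓ CS) (w : BasicModel.W M) → M , w ⊩ A

{-# OPTIONS --safe #-}
module Submission where

open import Defs
open import Axiom.ExcludedMiddle using (ExcludedMiddle)
open import Data.Empty.Polymorphic using (⊥-elim)
open import Data.List.Base using (List; [])
open import Data.List.Membership.Propositional using () renaming (_∈_ to _∈ˡ_)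
open import Data.List.Relation.Unary.All as All using (All; []; _∷_)
open import Data.Nat.Base using (ℕ; zero; suc)
open import Data.Product.Base using (_,_; proj₁; proj₂)
open import Data.Sum.Base using (inj₁; inj₂; [_,_]′)
open import Function.Bundles using (Equivalence)
open import Level using (lift; lower)
open import Relation.Binary.PropositionalEquality
  using (_≡_; refl; cong₂; subst)
open import Relation.Binary.Structures using (IsPreorder)
open import Relation.Nullary using (yes; no; contradiction)
open import Relation.Unary using (Pred; _∈_)

-- The axioms in Int are theorems of natural deduction, so their instances are
-- valid by the Kripke soundness of natural deduction, whose key is that truth
-- persists along ≤. The other axioms of Base and the rule can restate the
-- conditions on a basic model, up to (M2) and, for j▷, excluded middle.

substitute-var : ∀ φ → substitute var φ ≡ φ
substitute-var (var i) = refl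
substitute-var ⊥       = refl
substitute-var (φ ∧ ψ) = cong₂ _∧_ (substitute-var φ) (substitute-var ψ)
substitute-var (φ ∨ ψ) = cong₂ _∨_ (substitute-var φ) (substitute-var ψ)
substitute-var (φ ⇒ ψ) = cong₂ _⇒_ (substitute-var φ) (substitute-var ψ)

-- `ax` yields only substitution instances, so a scheme of `Int` is recovered as its own instance
-- under the identity substitution `var`.
axiom⇒⊢ⁿ : ∀ {Int φ} → AxiomatisesIPL Int → φ ∈ˡ Int → [] ⊢ⁿ φ
axiom⇒⊢ⁿ {Int} {φ} ipl φ∈Int =
  Equivalence.to (ipl φ) (subst (Int ⊢ᵐᵖ_) (substitute-var φ) (ax φ∈Int var))

module _ {c ℓ} {S : Signature} {CS : Pred (Formula S) c} (M : BasicModel ℓ CS) where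
  open BasicModel M
  open IsPreorder isPreorder using () renaming (refl to ≤-refl; trans to ≤-trans)

  -- Boxed and diamond formulas behave like atoms: their truth is membership in a set attached to
  -- the world, so (M2) settles them without recursion into the formula inside. For `⇒`,
  -- transitivity suffices.
  ⊩-mono : ∀ A {w v} → w ≤ v → M , w ⊩ A → M , v ⊩ A
  ⊩-mono (var p)   w≤v ⊩p          = lift (val-mono w≤v (lower ⊩p))
  ⊩-mono (A ∧ B)   w≤v (⊩A , ⊩B)   = ⊩-mono A w≤v ⊩A , ⊩-mono B w≤v ⊩B
  ⊩-mono (A ∨ B)   w≤v (inj₁ ⊩A)   = inj₁ (⊩-mono A w≤v ⊩A)
  ⊩-mono (A ∨ B)   w≤v (inj₂ ⊩B)   = inj₂ (⊩-mono B w≤v ⊩B)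
  ⊩-mono (A ⇒ B)   w≤v ⊩A⇒B u v≤u  = ⊩A⇒B u (≤-trans w≤v v≤u)
  ⊩-mono ([ t ] A) w≤v ⊩[t]A       = prf-mono w≤v ⊩[t]A
  ⊩-mono (⟨ m ⟩ A) w≤v ⊩⟨m⟩A       = sat-mono w≤v ⊩⟨m⟩A

  -- Schemes are interpreted through `σ`, so modal formulas enter only as values of metavariables.
  -- The world is quantified after the derivation because `⇒I` needs the induction hypothesis at a
  -- later world.
  ⊢ⁿ-sound : ∀ {Γ φ} (σ : ℕ → Formula S) → Γ ⊢ⁿ φ → ∀ {w} →
             All (λ ψ → M , w ⊩ instantiate σ ψ) Γ → M , w ⊩ instantiate σ φ
  ⊢ⁿ-sound σ (hyp φ∈Γ)  γ = All.lookup γ φ∈Γ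
  ⊢ⁿ-sound σ (⊥E d)     γ = ⊥-elim (⊢ⁿ-sound σ d γ)
  ⊢ⁿ-sound σ (∧I d e)   γ = ⊢ⁿ-sound σ d γ , ⊢ⁿ-sound σ e γ
  ⊢ⁿ-sound σ (∧E₁ d)    γ = proj₁ (⊢ⁿ-sound σ d γ)
  ⊢ⁿ-sound σ (∧E₂ d)    γ = proj₂ (⊢ⁿ-sound σ d γ)
  ⊢ⁿ-sound σ (∨I₁ d)    γ = inj₁ (⊢ⁿ-sound σ d γ)
  ⊢ⁿ-sound σ (∨I₂ d)    γ = inj₂ (⊢ⁿ-sound σ d γ)
  ⊢ⁿ-sound σ (∨E d e f) γ =
    [_,_]′ (λ ⊩φ → ⊢ⁿ-sound σ e (⊩φ ∷ γ)) (λ ⊩ψ → ⊢ⁿ-sound σ f (⊩ψ ∷ γ))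
      (⊢ⁿ-sound σ d γ)
  ⊢ⁿ-sound σ (⇒I d)     γ v w≤v ⊩φ =
    -- `φ` is assumed only at `v`; persistence carries the context there from the earlier world.
    ⊢ⁿ-sound σ d (⊩φ ∷ All.map (λ {ψ} → ⊩-mono (instantiate σ ψ) w≤v) γ)
  ⊢ⁿ-sound σ (⇒E d e)   γ = ⊢ⁿ-sound σ d γ _ ≤-refl (⊢ⁿ-sound σ e γ)

  Base-sound : ∀ {Int A} → ExcludedMiddle ℓ → AxiomatisesIPL Int →
               A ∈ Base Int → ∀ w → M , w ⊩ A
  Base-sound em ipl (int φ∈Int σ) w = ⊢ⁿ-sound σ (axiom⇒⊢ⁿ ipl φ∈Int) []
  Base-sound em ipl (j· s t A B)  w v _ A⇒B∈s u v≤u A∈t =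
    -- The two premises hold at different worlds; the one from `v` is moved up to `u`, where (1)
    -- combines them.
    prf-· (A , prf-mono v≤u A⇒B∈s , A∈t)
  Base-sound em ipl (j⋆ s m A B)  w v _ A⇒B∈s u v≤u A∈m =
    sat-⋆ (A , prf-mono v≤u A⇒B∈s , A∈m)
  Base-sound em ipl (j∨ m A B)    w v _ A∨B∈m = sat-∨ A∨B∈m
  Base-sound em ipl (j▷ m t A B)  w v _ A∈m⇒B∈t = prf-▷ A∉m⊎B∈t
    where
    A∉m⊎B∈t : ∀ u → v ≤ u → _
    -- Deciding membership turns the implication at `u` into the disjunction that (7) asks for.
    A∉m⊎B∈t u v≤u with em {A ∈ sat m u}
    ... | yes A∈m = inj₂ (A∈m⇒B∈t u v≤u A∈m)
    ... | no  A∉m = inj₁ A∉m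
  Base-sound em ipl (j⊥ m)        w v _ ⊥∈m = contradiction ⊥∈m sat-⊥
  Base-sound em ipl (j+₁ s t A)   w v _ A∈s = prf-+ (inj₁ A∈s)
  Base-sound em ipl (j+₂ s t A)   w v _ A∈t = prf-+ (inj₂ A∈t)
  Base-sound em ipl (j⊔₁ m n A)   w v _ A∈m = sat-⊔ (inj₁ A∈m)
  Base-sound em ipl (j⊔₂ m n A)   w v _ A∈n = sat-⊔ (inj₂ A∈n)

  -- The split on the exponent lets `canFormula` reduce to a boxed formula, whose truth is then
  -- exactly (5).
  Can-sound : ∀ {A} → A ∈ Can CS → ∀ w → M , w ⊩ A
  Can-sound (can cA∈CS zero)    w = prf-can (can cA∈CS zero)
  Can-sound (can cA∈CS (suc k)) w = prf-can (can cA∈CS (suc k))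

  ⊢-sound : ∀ {Int Γ A} → ExcludedMiddle ℓ → AxiomatisesIPL Int →
            Int , CS , Γ ⊢ A → ∀ {w} → All (M , w ⊩_) Γ → M , w ⊩ A
  ⊢-sound em ipl (ax A∈Base) γ = Base-sound em ipl A∈Base _
  ⊢-sound em ipl (id A∈Γ)    γ = All.lookup γ A∈Γ
  ⊢-sound em ipl (mp d e)    γ = ⊢-sound em ipl e γ _ ≤-refl (⊢-sound em ipl d γ)
  ⊢-sound em ipl (can A∈Can) γ = Can-sound A∈Can _

theorem3p4 : ∀ {c ℓ} → ExcludedMiddle ℓ →
    (S : Signature) (Int : List Scheme) → AxiomatisesIPL Int →
    (CS : Pred (Formula S) c) → IsConstantSpecification Int CS →
    (A : Formula S) → Int , CS , [] ⊢ A → ⊨ᵇ ℓ CS A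
theorem3p4 em S Int ipl CS _ A d M w = ⊢-sound M em ipl d []
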